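{- There exists $n_1$ such that for every $P^4_2$-free $4$-graph $H$ with $n\ge n_1$ vertices and $m\ge \binom{\lfloor n/2\rfloor}{2}+1$ edges we have $\Delta(H)\ge n^2/32-n$. On the other hand, for every $n\ge 4$ there exists a $P^4_2$-free $4$-graph $H_0$ with $n$ vertices, $m=\binom{\lfloor n/2\rfloor}{2}$ edges and $\Delta(H_0)=\lfloor n/2\rfloor-1$.
   Context: A $k$-graph $H=(V,E)$ is a family $E$ of (distinct) $k$-element subsets (edges) of a finite vertex set $V$. The degree of a vertex is the number of edges containing it, and $\Delta(H)$ is the maximum degree of $H$. The loose path $P^k_\ell$ is the connected linear $k$-graph with $\ell$ edges and $k\ell-\ell+1$ vertices; in particular $P^4_2$ consists of two $4$-element edges sharing exactly one vertex. $H$ is $P^k_\ell$-free if it contains no (not necessarily induced) copy of $P^k_\ell$. -}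

module Defs where

open import Data.Nat using (ℕ; _⊔_)
open import Data.Fin using (Fin)
open import Data.Fin.Subset using (Subset; _∈_; _∩_; ∣_∣)
open import Data.Fin.Subset.Properties using (_∈?_)
open import Data.List using (List; length; filter; foldr; allFin; map)
open import Data.List.Relation.Unary.Unique.Propositional using (Unique)
open import Data.List.Relation.Unary.All using (All)
open import Data.List.Membership.Propositional renaming (_∈_ to _∈ₗ_)
open import Relation.Binary.PropositionalEquality using (_≡_; _≢_)

record FourGraph (n : ℕ) : Set where
  field
    edges    : List (Subset n)
    distinct : Unique edges
    uniform  : All (λ e → ∣ e ∣ ≡ 4) edges
open FourGraph public

numEdges : ∀ {n} → FourGraph n → ℕ
numEdges H = length (edges H)

degree : ∀ {n} → FourGraph n → Fin n → ℕ
degree H v = length (filter (v ∈?_) (edges H))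

maxDegree : ∀ {n} → FourGraph n → ℕ
maxDegree {n} H = foldr _⊔_ 0 (map (degree H) (allFin n))

-- H contains a copy of P^4_2 iff two edges of H share exactly one vertex
-- (two 4-edges meeting in exactly one vertex are automatically distinct).
P42-free : ∀ {n} → FourGraph n → Set
P42-free H = ∀ {e f} → e ∈ₗ edges H → f ∈ₗ edges H → ∣ e ∩ f ∣ ≢ 1

{-# OPTIONS --safe #-}

-- Call a vertex set heavy if no three further vertices meet all the edges containing it.  Since
-- no two edges meet in a single vertex, no edge meets a heavy set in a single vertex.  Hence every
-- edge contains a heavy pair or is disjoint from it, and the h heavy pairs are disjoint.  Call a vertex
-- x outside them good for the heavy pair p if p ∪ {x} is heavy; x is good for at most one p.  Each edge
-- is of one of three kinds:
--   a union of two heavy pairs, giving at most C(h,2) edges;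
--   p ∪ {x,y} with x, y good for p, giving at most min(C(g,2), Δ) ≤ g √(Δ/2) edges if g vertices
--   are good for p, and √(Δ/2) ≤ n/8 - 2 when Δ < n²/32 - n;
--   an edge charged to a vertex x that is outside all heavy pairs and good for none, at most 54 for
--   each x: they are found by branching three times over small covers of non-heavy sets.
-- So m ≤ C(h,2) + (n - 2h)(n/8 - 2) for n ≥ 448, which is at most C(⌊n/2⌋,2) if n - 2h ≥ 2;
-- otherwise only the first kind occurs.
--
-- The extremal graph consists of the unions of two blocks {2i, 2i+1}.
module Submission where

open import Defs
open import Data.Nat using (ℕ; s≤s⁻¹; zero; suc; _+_; _*_; _∸_; _≤_; _<_; _/_; _⊔_; z≤n; s≤s; _≤?_)
open import Data.Nat.Properties
open import Data.Nat.DivMod using (_%_; m≡m%n+[m/n]*n; m%n<n; m*n/n≡m; /-monoˡ-≤; m/n*n≤m)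
open import Data.Nat.Combinatorics using (_C_; nC1≡n; nCk+nC[k+1]≡[n+1]C[k+1])
open import Data.Nat.Tactic.RingSolver using (solve-∀)
open import Data.Fin using (Fin; zero; suc; toℕ; fromℕ<)
import Data.Fin as Fin
import Data.Fin.Properties as Fin
open import Data.Fin.Subset using (Subset; _∈_; _∩_; _∪_; ∣_∣; ⁅_⁆; ⊥; inside; outside)
open import Data.Fin.Subset.Properties
open import Data.Vec using ([]; _∷_)
import Data.Vec as Vec
open import Data.List using (List; []; _∷_; _++_; length; filter; foldr; allFin; map; concatMap; [_])
open import Data.List.Properties using (length-map; length-++; length-++-sucʳ; length-filter; length-tabulate; map-++; map-∘; filter-++; filter-all; filter-none; filter-accept; filter-reject)
open import Data.List.Membership.Propositional renaming (_∈_ to _∈ₗ_; _∉_ to _∉ₗ_)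
open import Data.List.Membership.Propositional.Properties
import Data.List.Membership.DecPropositional as DecMembership
open import Data.List.Relation.Binary.Subset.Propositional using () renaming (_⊆_ to _⊆ₗ_)
open import Data.List.Relation.Unary.All using (All; []; _∷_)
import Data.List.Relation.Unary.All as All
import Data.List.Relation.Unary.All.Properties as All
open import Data.List.Relation.Unary.AllPairs using (AllPairs; []; _∷_)
import Data.List.Relation.Unary.AllPairs as AllPairs
import Data.List.Relation.Unary.AllPairs.Properties as AllPairs
open import Data.List.Relation.Unary.Any using (Any; here; there)
import Data.List.Relation.Unary.Any as Any
open import Data.List.Relation.Unary.Unique.Propositional using (Unique)
import Data.List.Relation.Unary.Unique.Propositional.Properties as Unique
open import Data.Product using (Σ; ∃; _×_; _,_; proj₁; proj₂)
import Data.Empty as Empty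
open import Data.Sum using (_⊎_; inj₁; inj₂; [_,_]′)
open import Function using (_∘_; id)
open import Relation.Binary.PropositionalEquality hiding ([_])
open import Relation.Nullary
open import Relation.Nullary.Decidable using (decidable-stable; ¬?; _×-dec_; _→-dec_)

private variable
  A B : Set
  n : ℕ

-- Counting with duplicate-free lists

unique-⊆-length : {xs ys : List A} → Unique xs → xs ⊆ₗ ys → length xs ≤ length ys
unique-⊆-length [] _ = z≤n
unique-⊆-length {ys = ys} (x∉ ∷ u) xs⊆ys with ∈-∃++ (xs⊆ys (here refl))
... | as , bs , refl = begin
  suc _                 ≤⟨ s≤s (unique-⊆-length u rest) ⟩
  suc (length (as ++ bs)) ≡⟨ length-++-sucʳ as _ bs ⟨
  length (as ++ _ ∷ bs) ∎
  where
  open ≤-Reasoning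
  rest : ∀ {y} → y ∈ₗ _ → y ∈ₗ as ++ bs
  rest y∈ with ∈-++⁻ as (xs⊆ys (there y∈))
  ... | inj₁ p          = ∈-++⁺ˡ p
  ... | inj₂ (here refl) = contradiction refl (All.lookup x∉ y∈)
  ... | inj₂ (there p)  = ∈-++⁺ʳ as p

unique-map-on : {f : A → B} {xs : List A} →
  (∀ {x y} → x ∈ₗ xs → y ∈ₗ xs → f x ≡ f y → x ≡ y) → Unique xs → Unique (map f xs)
unique-map-on inj [] = []
unique-map-on inj (x∉ ∷ u) =
  All.map⁺ (All.tabulate λ y∈ eq → All.lookup x∉ y∈ (inj (here refl) (there y∈) eq))
  ∷ unique-map-on (λ p q → inj (there p) (there q)) u

concatMap-length-≤ : ∀ k (f : A → List B) → (∀ x → length (f x) ≤ k) →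
  ∀ xs → length (concatMap f xs) ≤ length xs * k
concatMap-length-≤ k f f≤ [] = z≤n
concatMap-length-≤ k f f≤ (x ∷ xs) = begin
  length (f x ++ concatMap f xs)        ≡⟨ length-++ (f x) ⟩
  length (f x) + length (concatMap f xs) ≤⟨ +-mono-≤ (f≤ x) (concatMap-length-≤ k f f≤ xs) ⟩
  k + length xs * k ∎
  where open ≤-Reasoning

-- The factors `j` and `k` encode a rational ratio, so that the estimate of stars by good vertices
-- can be summed over all heavy pairs without division.
concatMap-length-ratio : ∀ j k (f : A → List B) {C : Set} (g : A → List C) →
  (∀ x → j * length (f x) ≤ k * length (g x)) →
  ∀ xs → j * length (concatMap f xs) ≤ k * length (concatMap g xs)
concatMap-length-ratio j k f g f≤g [] = ≤-reflexive (trans (*-zeroʳ j) (sym (*-zeroʳ k)))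
concatMap-length-ratio j k f g f≤g (x ∷ xs) = begin
  j * length (f x ++ concatMap f xs)                 ≡⟨ cong (j *_) (length-++ (f x)) ⟩
  j * (length (f x) + length (concatMap f xs))       ≡⟨ *-distribˡ-+ j _ _ ⟩
  j * length (f x) + j * length (concatMap f xs)     ≤⟨ +-mono-≤ (f≤g x) (concatMap-length-ratio j k f g f≤g xs) ⟩
  k * length (g x) + k * length (concatMap g xs)     ≡⟨ *-distribˡ-+ k _ _ ⟨
  k * (length (g x) + length (concatMap g xs))       ≡⟨ cong (k *_) (length-++ (g x)) ⟨
  k * length (g x ++ concatMap g xs) ∎
  where open ≤-Reasoning

∈-concatMap : {f : A → List B} {xs : List A} {x : A} {y : B} →
  x ∈ₗ xs → y ∈ₗ f x → y ∈ₗ concatMap f xs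
∈-concatMap {f = f} x∈ y∈ = ∈-concatMap⁺ f (Any.map (λ { refl → y∈ }) x∈)

unique-concatMap : {f : A → List B} {xs : List A} → (∀ {x} → x ∈ₗ xs → Unique (f x)) →
  (∀ {x y z} → x ∈ₗ xs → y ∈ₗ xs → z ∈ₗ f x → z ∈ₗ f y → x ≡ y) →
  Unique xs → Unique (concatMap f xs)
unique-concatMap uf dis [] = []
unique-concatMap {f = f} uf dis (x∉ ∷ u) =
  Unique.++⁺ (uf (here refl)) (unique-concatMap (uf ∘ there) (λ p q → dis (there p) (there q)) u)
    λ (z∈ , z∈′) → let (y , y∈ , z∈y) = find (∈-concatMap⁻ f z∈′) in
      All.lookup x∉ y∈ (dis (here refl) (there y∈) z∈ z∈y)

-- Unordered pairs and binomial coefficients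

pairs : List A → List (A × A)
pairs []       = []
pairs (x ∷ xs) = map (x ,_) xs ++ pairs xs

length-pairs : (xs : List A) → length (pairs xs) ≡ length xs C 2
length-pairs [] = refl
length-pairs (x ∷ xs) = begin
  length (map (x ,_) xs ++ pairs xs)         ≡⟨ length-++ (map (x ,_) xs) ⟩
  length (map (x ,_) xs) + length (pairs xs) ≡⟨ cong₂ _+_ (length-map (x ,_) xs) (length-pairs xs) ⟩
  length xs + length xs C 2                  ≡⟨ cong (_+ length xs C 2) (nC1≡n (length xs)) ⟨
  length xs C 1 + length xs C 2              ≡⟨ nCk+nC[k+1]≡[n+1]C[k+1] (length xs) 1 ⟩
  suc (length xs) C 2 ∎
  where open ≡-Reasoning

-- `pairs` follows the order of the list, so the orientation that occurs depends on which of `x` and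
-- `y` comes first.
∈-pairs⁺ : {xs : List A} {x y : A} → x ∈ₗ xs → y ∈ₗ xs → x ≢ y →
  (x , y) ∈ₗ pairs xs ⊎ (y , x) ∈ₗ pairs xs
∈-pairs⁺ (here refl) (here refl) x≢y = contradiction refl x≢y
∈-pairs⁺ (here refl) (there y∈)  x≢y = inj₁ (∈-++⁺ˡ (∈-map⁺ _ y∈))
∈-pairs⁺ (there x∈)  (here refl) x≢y = inj₂ (∈-++⁺ˡ (∈-map⁺ _ x∈))
∈-pairs⁺ {xs = z ∷ xs} (there x∈) (there y∈) x≢y with ∈-pairs⁺ x∈ y∈ x≢y
... | inj₁ p = inj₁ (∈-++⁺ʳ (map (z ,_) xs) p)
... | inj₂ p = inj₂ (∈-++⁺ʳ (map (z ,_) xs) p)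

pairs-All : {xs : List A} {R : A → A → Set} → AllPairs R xs → All (λ (x , y) → R x y) (pairs xs)
pairs-All [] = []
pairs-All (r ∷ rs) = All.++⁺ (All.map⁺ r) (pairs-All rs)

∈-pairs⁻ : (xs : List A) {p : A × A} → p ∈ₗ pairs xs → proj₁ p ∈ₗ xs × proj₂ p ∈ₗ xs
∈-pairs⁻ (x ∷ xs) p∈ with ∈-++⁻ (map (x ,_) xs) p∈
... | inj₁ q with ∈-map⁻ (x ,_) q
...   | y , y∈ , refl = here refl , there y∈
∈-pairs⁻ (x ∷ xs) p∈ | inj₂ q with ∈-pairs⁻ xs q
...   | a , b = there a , there b

unique-pairs : {xs : List A} → Unique xs → Unique (pairs xs)
unique-pairs [] = []
unique-pairs {xs = x ∷ xs} (x∉ ∷ u) =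
  Unique.++⁺ (Unique.map⁺ (λ { refl → refl }) u) (unique-pairs u)
    λ { (p , q) → let (y , _ , eq) = ∈-map⁻ (x ,_) p in
          All.lookup x∉ (subst (_∈ₗ xs) (cong proj₁ eq) (proj₁ (∈-pairs⁻ xs q))) refl }

-- Heavy pairs and pairs of block indices are stored in increasing order; this recovers equality of
-- pairs from inclusion of their members.
sorted-pair-≡ : {a b c d : Fin n} → a Fin.< b → c Fin.< d →
  a ∈ₗ c ∷ d ∷ [] → b ∈ₗ c ∷ d ∷ [] → (a , b) ≡ (c , d)
sorted-pair-≡ a<b c<d (here refl)         (there (here refl)) = refl
sorted-pair-≡ a<b c<d (here refl)         (here refl)         = contradiction refl (Fin.<⇒≢ a<b)
sorted-pair-≡ a<b c<d (there (here refl)) (there (here refl)) = contradiction refl (Fin.<⇒≢ a<b)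
sorted-pair-≡ a<b c<d (there (here refl)) (here refl)         = contradiction a<b (<-asym c<d)

2*C2 : ∀ k → 2 * (k C 2) ≡ k * (k ∸ 1)
2*C2 zero = refl
2*C2 (suc zero) = refl
2*C2 (suc k@(suc j)) = begin
  2 * (suc k C 2)             ≡⟨ cong (2 *_) (nCk+nC[k+1]≡[n+1]C[k+1] k 1) ⟨
  2 * (k C 1 + k C 2)         ≡⟨ *-distribˡ-+ 2 (k C 1) (k C 2) ⟩
  2 * (k C 1) + 2 * (k C 2)   ≡⟨ cong₂ (λ a b → 2 * a + b) (nC1≡n k) (2*C2 k) ⟩
  2 * suc j + suc j * j       ≡⟨ arith j ⟩
  suc (suc j) * suc j ∎
  where
  open ≡-Reasoning
  arith : ∀ j → 2 * suc j + suc j * j ≡ suc (suc j) * suc j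
  arith = solve-∀

C2-mono : ∀ {j k} → j ≤ k → j C 2 ≤ k C 2
C2-mono {j} {k} j≤k = *-cancelˡ-≤ 2 (begin
  2 * (j C 2)   ≡⟨ 2*C2 j ⟩
  j * (j ∸ 1)   ≤⟨ *-mono-≤ j≤k (∸-monoˡ-≤ 1 j≤k) ⟩
  k * (k ∸ 1)   ≡⟨ 2*C2 k ⟨
  2 * (k C 2) ∎)
  where open ≤-Reasoning

-- Plays the role of a minimum: it keeps every common member of the two lists, and either length
-- bounds it.
shorter : List A → List A → List A
shorter xs ys with length xs ≤? length ys
... | yes _ = xs
... | no _  = ys

∈-shorter : {xs ys : List A} {x : A} → x ∈ₗ xs → x ∈ₗ ys → x ∈ₗ shorter xs ys
∈-shorter {xs = xs} {ys} x∈xs x∈ys with length xs ≤? length ys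
... | yes _ = x∈xs
... | no _  = x∈ys

shorter-≤ˡ : (xs ys : List A) → length (shorter xs ys) ≤ length xs
shorter-≤ˡ xs ys with length xs ≤? length ys
... | yes _ = ≤-refl
... | no gt = <⇒≤ (≰⇒> gt)

shorter-≤ʳ : (xs ys : List A) → length (shorter xs ys) ≤ length ys
shorter-≤ʳ xs ys with length xs ≤? length ys
... | yes le = le
... | no _   = ≤-refl

square-cancel-≤ : ∀ {j k} → j * j ≤ k * k → j ≤ k
square-cancel-≤ {j} {k} le with j ≤? k
... | yes p = p
... | no ¬p = contradiction le (<⇒≱ (*-mono-< (≰⇒> ¬p) (≰⇒> ¬p)))

-- `k` is at most the geometric mean of its two bounds: the square of 8k is the product of 32k and
-- 2k, and `2 * (g C 2)` is at most `g * g`.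
geometric-mean : ∀ t d {k g} → k ≤ d → k ≤ g C 2 → 32 * d ≤ t * t → 8 * k ≤ t * g
geometric-mean t d {k} {g} k≤d k≤g d≤t = square-cancel-≤ (begin
  8 * k * (8 * k)     ≡⟨ arith₁ k ⟩
  32 * k * (2 * k)    ≤⟨ *-mono-≤ (*-monoʳ-≤ 32 k≤d) (*-monoʳ-≤ 2 k≤g) ⟩
  32 * d * (2 * (g C 2)) ≤⟨ *-mono-≤ d≤t (≤-trans (≤-reflexive (2*C2 g)) (*-monoʳ-≤ g (m∸n≤m g 1))) ⟩
  t * t * (g * g)     ≡⟨ arith₂ t g ⟩
  t * g * (t * g) ∎)
  where
  open ≤-Reasoning
  arith₁ : ∀ k → 8 * k * (8 * k) ≡ 32 * k * (2 * k)
  arith₁ = solve-∀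
  arith₂ : ∀ t g → t * t * (g * g) ≡ t * g * (t * g)
  arith₂ = solve-∀

-- Maximum degree

≤-foldr-⊔ : {k : ℕ} {xs : List ℕ} → k ∈ₗ xs → k ≤ foldr _⊔_ 0 xs
≤-foldr-⊔ (here refl) = m≤m⊔n _ _
≤-foldr-⊔ (there k∈) = ≤-trans (≤-foldr-⊔ k∈) (m≤n⊔m _ _)

foldr-⊔-≤ : {k : ℕ} {xs : List ℕ} → All (_≤ k) xs → foldr _⊔_ 0 xs ≤ k
foldr-⊔-≤ [] = z≤n
foldr-⊔-≤ (p ∷ ps) = ⊔-lub p (foldr-⊔-≤ ps)

degree≤maxDegree : (H : FourGraph n) (v : Fin n) → degree H v ≤ maxDegree H
degree≤maxDegree H v = ≤-foldr-⊔ (∈-map⁺ (degree H) (∈-allFin v))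

-- Subsets of `Fin n` as lists

elements : Subset n → List (Fin n)
elements []            = []
elements (inside  ∷ s) = zero ∷ map suc (elements s)
elements (outside ∷ s) = map suc (elements s)

length-elements : (s : Subset n) → length (elements s) ≡ ∣ s ∣
length-elements []            = refl
length-elements (inside  ∷ s) = cong suc (trans (length-map suc (elements s)) (length-elements s))
length-elements (outside ∷ s) = trans (length-map suc (elements s)) (length-elements s)

unique-elements : (s : Subset n) → Unique (elements s)
unique-elements []            = []
unique-elements (inside  ∷ s) =
  All.map⁺ (All.universal (λ _ ()) (elements s)) ∷ Unique.map⁺ Fin.suc-injective (unique-elements s)
unique-elements (outside ∷ s) = Unique.map⁺ Fin.suc-injective (unique-elements s)

∈-elements⁺ : {x : Fin n} {s : Subset n} → x ∈ s → x ∈ₗ elements s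
∈-elements⁺ {s = inside ∷ s}  Vec.here        = here refl
∈-elements⁺ {s = inside ∷ s}  (Vec.there x∈) = there (∈-map⁺ suc (∈-elements⁺ x∈))
∈-elements⁺ {s = outside ∷ s} (Vec.there x∈) = ∈-map⁺ suc (∈-elements⁺ x∈)

∈-elements⁻ : {x : Fin n} {s : Subset n} → x ∈ₗ elements s → x ∈ s
∈-elements⁻ {s = inside ∷ s}  (here refl) = Vec.here
∈-elements⁻ {s = inside ∷ s}  (there x∈) with ∈-map⁻ suc x∈
... | y , y∈ , refl = Vec.there (∈-elements⁻ y∈)
∈-elements⁻ {s = outside ∷ s} x∈ with ∈-map⁻ suc x∈
... | y , y∈ , refl = Vec.there (∈-elements⁻ y∈)

⟦_⟧ : List (Fin n) → Subset n
⟦_⟧ = foldr (λ x s → ⁅ x ⁆ ∪ s) ⊥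

∈-⟦⟧⁺ : {x : Fin n} {xs : List (Fin n)} → x ∈ₗ xs → x ∈ ⟦ xs ⟧
∈-⟦⟧⁺ {x = x} (here refl) = x∈p∪q⁺ (inj₁ (x∈⁅x⁆ x))
∈-⟦⟧⁺ (there x∈)  = x∈p∪q⁺ (inj₂ (∈-⟦⟧⁺ x∈))

∈-⟦⟧⁻ : {x : Fin n} (xs : List (Fin n)) → x ∈ ⟦ xs ⟧ → x ∈ₗ xs
∈-⟦⟧⁻ [] x∈ = contradiction x∈ ∉⊥
∈-⟦⟧⁻ (y ∷ xs) x∈ with x∈p∪q⁻ ⁅ y ⁆ ⟦ xs ⟧ x∈
... | inj₁ p = here (x∈⁅y⁆⇒x≡y y p)
... | inj₂ p = there (∈-⟦⟧⁻ xs p)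

module _ {n : ℕ} where
  open DecMembership (Fin._≟_ {n}) public using () renaming (_∈?_ to _∈ₗ?_)

⊆-∣∣ : {xs : List (Fin n)} {s : Subset n} → Unique xs → All (_∈ s) xs → length xs ≤ ∣ s ∣
⊆-∣∣ {s = s} u xs⊆s = subst (_ ≤_) (length-elements s)
  (unique-⊆-length u (∈-elements⁺ ∘ All.lookup xs⊆s))

∣∣-⊆ : {xs : List (Fin n)} {s : Subset n} → (∀ {x} → x ∈ s → x ∈ₗ xs) → ∣ s ∣ ≤ length xs
∣∣-⊆ {s = s} s⊆xs = subst (_≤ _) (length-elements s)
  (unique-⊆-length (unique-elements s) (s⊆xs ∘ ∈-elements⁻))

∣⟦⟧∣ : {xs : List (Fin n)} → Unique xs → ∣ ⟦ xs ⟧ ∣ ≡ length xs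
∣⟦⟧∣ {xs = xs} u = ≤-antisym (∣∣-⊆ (∈-⟦⟧⁻ xs)) (⊆-∣∣ u (All.tabulate ∈-⟦⟧⁺))

-- A member of `s` missing from `xs` would extend it to a duplicate-free list longer than `∣ s ∣`.
exhaust : {xs : List (Fin n)} {s : Subset n} → Unique xs → All (_∈ s) xs → ∣ s ∣ ≤ length xs →
  ∀ {y} → y ∈ s → y ∈ₗ xs
exhaust {xs = xs} u xs⊆s s≤ {y} y∈s with y ∈ₗ? xs
... | yes y∈ = y∈
... | no y∉ = contradiction (≤-trans (⊆-∣∣ (All.¬Any⇒All¬ xs y∉ ∷ u) (y∈s ∷ xs⊆s)) s≤) (<-irrefl refl)

fresh : (xs : List (Fin n)) {s : Subset n} → length xs < ∣ s ∣ → ∃ λ y → y ∈ s × y ∉ₗ xs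
fresh xs {s} lt with All.all? (_∈ₗ? xs) (elements s)
... | yes s⊆xs = contradiction (∣∣-⊆ {s = s} (λ x∈ → All.lookup s⊆xs (∈-elements⁺ x∈))) (<⇒≱ lt)
... | no s⊈xs = let (y , y∈ , y∉) = find (All.¬All⇒Any¬ (_∈ₗ? xs) (elements s) s⊈xs) in y , ∈-elements⁻ y∈ , y∉

≡⟦⟧ : {xs : List (Fin n)} {s : Subset n} → Unique xs → All (_∈ s) xs → ∣ s ∣ ≤ length xs → s ≡ ⟦ xs ⟧
≡⟦⟧ {xs = xs} u xs⊆s s≤ = ⊆-antisym (∈-⟦⟧⁺ ∘ exhaust u xs⊆s s≤) (All.lookup xs⊆s ∘ ∈-⟦⟧⁻ xs)

∣∣≡1 : {x : Fin n} {s : Subset n} → x ∈ s → (∀ {y} → y ∈ s → y ≡ x) → ∣ s ∣ ≡ 1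
∣∣≡1 {x = x} x∈ only = ≤-antisym (∣∣-⊆ {xs = [ x ]} (here ∘ only)) (⊆-∣∣ {xs = [ x ]} ([] ∷ []) (x∈ ∷ []))

-- Heavy sets, and covers of light sets

module Structure {n : ℕ} (H : FourGraph n) (free : P42-free H) where

  E : List (Subset n)
  E = edges H

  size : ∀ {e} → e ∈ₗ E → ∣ e ∣ ≡ 4
  size = All.lookup (uniform H)

  Avoids : List (Fin n) → List (Fin n) → Subset n → Set
  Avoids S W e = All (_∈ e) S × All (λ w → w ∈ e → w ∈ₗ S) W

  avoids? : ∀ S W e → Dec (Avoids S W e)
  avoids? S W e = All.all? (_∈? e) S ×-dec All.all? (λ w → w ∈? e →-dec w ∈ₗ? S) W

  -- A substitute for "S is the kernel of a large sunflower": no three vertices outside S meet all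
  -- edges containing S.  Three is the number of further vertices of an edge through one vertex of S.
  Heavy : List (Fin n) → Set
  Heavy S = ∀ u v w → Any (Avoids S (u ∷ v ∷ w ∷ [])) E

  abstract
    heavy? : ∀ S → Dec (Heavy S)
    heavy? S = Fin.all? λ u → Fin.all? λ v → Fin.all? λ w → Any.any? (avoids? S (u ∷ v ∷ w ∷ [])) E

  heavy-resp : ∀ {S T} → S ⊆ₗ T → T ⊆ₗ S → Heavy S → Heavy T
  heavy-resp S⊆T T⊆S h u v w =
    Any.map (λ (S⊆e , av) → All.tabulate (All.lookup S⊆e ∘ T⊆S) , All.map (S⊆T ∘_) av) (h u v w)

  -- Negating the quantifiers of `Heavy` one at a time over the finite vertex set yields three
  -- explicit vertices. An edge containing `S` but none of them outside `S` would contradict their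
  -- choice.
  light-cover : ∀ S → ¬ Heavy S → ∃ λ W → length W ≡ 3 ×
    (∀ {e} → e ∈ₗ E → All (_∈ e) S → ∃ λ w → w ∈ₗ W × w ∈ e × w ∉ₗ S)
  light-cover S light
    with (u , ¬u) ← Fin.¬∀⟶∃¬ n _ (λ u → Fin.all? λ v → Fin.all? λ w → Any.any? (avoids? S (u ∷ v ∷ w ∷ [])) E) light
    with (v , ¬v) ← Fin.¬∀⟶∃¬ n _ (λ v → Fin.all? λ w → Any.any? (avoids? S (u ∷ v ∷ w ∷ [])) E) ¬u
    with (w , ¬w) ← Fin.¬∀⟶∃¬ n _ (λ w → Any.any? (avoids? S (u ∷ v ∷ w ∷ [])) E) ¬v
    = u ∷ v ∷ w ∷ [] , refl , hit
    where
    hit : ∀ {e} → e ∈ₗ E → All (_∈ e) S → ∃ λ z → z ∈ₗ u ∷ v ∷ w ∷ [] × z ∈ e × z ∉ₗ S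
    hit {e} e∈ S⊆e with Any.any? (λ z → z ∈? e ×-dec ¬? (z ∈ₗ? S)) (u ∷ v ∷ w ∷ [])
    ... | yes p = find p
    ... | no ¬p = contradiction (lose e∈ (S⊆e , All.map (λ {z} q z∈e → decidable-stable (z ∈ₗ? S) (λ z∉ → q (z∈e , z∉))) (All.¬Any⇒All¬ _ ¬p))) ¬w

  Hits : List (Fin n) → List (Fin n) → Set
  Hits W S = ∀ {e} → e ∈ₗ E → All (_∈ e) S → ∃ λ w → w ∈ₗ W × w ∈ e × w ∉ₗ S

  -- The bound 3 includes heavy sets, whose cover is empty by default; candidates can thus be
  -- counted without knowing which sets are light.
  CoverOf : List (Fin n) → List (Fin n) → Set
  CoverOf S W = length W ≤ 3 × (¬ Heavy S → length W ≡ 3 × Hits W S)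

  ∃-cover : ∀ S → Dec (Heavy S) → ∃ (CoverOf S)
  ∃-cover S (yes h) = [] , z≤n , λ light → contradiction h light
  ∃-cover S (no light) = let (W , len , hits) = light-cover S light in
    W , ≤-reflexive len , λ _ → len , hits

  abstract
    cover : List (Fin n) → List (Fin n)
    cover S = proj₁ (∃-cover S (heavy? S))

    cover-spec : ∀ S → CoverOf S (cover S)
    cover-spec S = proj₂ (∃-cover S (heavy? S))

  cover-hits : ∀ {S} → ¬ Heavy S → Hits (cover S) S
  cover-hits {S} light = proj₂ (proj₂ (cover-spec S) light)

  heavy-avoid : ∀ {S} → Heavy S → ∀ W → length W ≡ 3 → ∃ λ e → e ∈ₗ E × Avoids S W e
  heavy-avoid h (u ∷ v ∷ w ∷ []) refl = find (h u v w)

  -- If c missed the cover of {a,b}, heaviness of {a,b,c} would give an edge through a, b that it misses.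
  heavy-extends-into-cover : ∀ {a b c} → ¬ Heavy (a ∷ b ∷ []) → Heavy (a ∷ b ∷ c ∷ []) → c ∈ₗ cover (a ∷ b ∷ [])
  heavy-extends-into-cover {a} {b} {c} light h =
    let (len , hits) = proj₂ (cover-spec (a ∷ b ∷ [])) light
        (e , e∈ , S⊆e , av) = heavy-avoid h (cover (a ∷ b ∷ [])) len
        (w , w∈W , w∈e , w∉) = hits e∈ (All.head S⊆e ∷ All.head (All.tail S⊆e) ∷ [])
    in subst (_∈ₗ cover (a ∷ b ∷ [])) (third (All.lookup av w∈W w∈e) w∉) w∈W
    where
    third : ∀ {w} → w ∈ₗ a ∷ b ∷ c ∷ [] → w ∉ₗ a ∷ b ∷ [] → w ≡ c
    third (here p) w∉ = contradiction (here p) w∉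
    third (there (here p)) w∉ = contradiction (there (here p)) w∉
    third (there (there (here p))) w∉ = p

  rest-of : ∀ {e x} → e ∈ₗ E → x ∈ e → ∃ λ W → length W ≡ 3 × (∀ {y} → y ∈ e → y ≢ x → y ∈ₗ W)
  rest-of {e} {x} e∈ x∈
    with (u , u∈ , u∉) ← fresh (x ∷ []) {e} (subst (_ <_) (sym (size e∈)) (s≤s (s≤s z≤n)))
    with (v , v∈ , v∉) ← fresh (u ∷ x ∷ []) {e} (subst (_ <_) (sym (size e∈)) (s≤s (s≤s (s≤s z≤n))))
    with (w , w∈ , w∉) ← fresh (v ∷ u ∷ x ∷ []) {e} (subst (_ <_) (sym (size e∈)) ≤-refl)
    = w ∷ v ∷ u ∷ [] , refl , λ y∈ y≢x → drop-x y≢x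
        (exhaust (All.¬Any⇒All¬ _ w∉ ∷ All.¬Any⇒All¬ _ v∉ ∷ All.¬Any⇒All¬ _ u∉ ∷ [] ∷ [])
          (w∈ ∷ v∈ ∷ u∈ ∷ x∈ ∷ []) (≤-reflexive (size e∈)) y∈)
    where
    drop-x : ∀ {a b c y} → y ≢ x → y ∈ₗ a ∷ b ∷ c ∷ x ∷ [] → y ∈ₗ a ∷ b ∷ c ∷ []
    drop-x y≢x (here p) = here p
    drop-x y≢x (there (here p)) = there (here p)
    drop-x y≢x (there (there (here p))) = there (there (here p))
    drop-x y≢x (there (there (there (here p)))) = contradiction p y≢x

  -- Heaviness yields an edge `e` containing `S` whose vertices among the other three of `f` all lie
  -- in `S`. As `f` meets `S` in `x` alone, `e` and `f` share only `x`, which `free` forbids.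
  heavy-no-single : ∀ {S x f} → Heavy S → x ∈ₗ S → f ∈ₗ E → x ∈ f → (∀ {s} → s ∈ₗ S → s ∈ f → s ≡ x) → Empty.⊥
  heavy-no-single {S} {x} {f} h x∈S f∈ x∈f only
    with (W , len , rest) ← rest-of f∈ x∈f
    with (e , e∈ , S⊆e , av) ← heavy-avoid h W len
    = free e∈ f∈ (∣∣≡1 (x∈p∩q⁺ (All.lookup S⊆e x∈S , x∈f)) λ y∈ → common (x∈p∩q⁻ e f y∈))
    where
    common : ∀ {y} → y ∈ e × y ∈ f → y ≡ x
    common {y} (y∈e , y∈f) with y Fin.≟ x
    ... | yes p = p
    ... | no y≢x = only (All.lookup av (rest y∈f y≢x) y∈e) y∈f

  -- Disjoint heavy pairs

  vs : Fin n × Fin n → List (Fin n)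
  vs (a , b) = a ∷ b ∷ []

  vs-swap : ∀ {a b} → vs (a , b) ⊆ₗ vs (b , a)
  vs-swap (here p) = there (here p)
  vs-swap (there (here p)) = here p

  P : List (Fin n × Fin n)
  P = filter (heavy? ∘ vs) (pairs (allFin n))

  P-heavy : ∀ {p} → p ∈ₗ P → Heavy (vs p)
  P-heavy = proj₂ ∘ ∈-filter⁻ (heavy? ∘ vs) {xs = pairs (allFin n)}

  P-sorted : ∀ {p} → p ∈ₗ P → proj₁ p Fin.< proj₂ p
  P-sorted p∈ = All.lookup (pairs-All {xs = allFin n} {R = Fin._<_} (AllPairs.tabulate⁺-< id)) (proj₁ (∈-filter⁻ (heavy? ∘ vs) {xs = pairs (allFin n)} p∈))

  unique-vs : ∀ {p} → p ∈ₗ P → Unique (vs p)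
  unique-vs p∈ = (Fin.<⇒≢ (P-sorted p∈) ∷ []) ∷ [] ∷ []

  heavy-pair : ∀ {a b} → a ≢ b → Heavy (a ∷ b ∷ []) → ∃ λ p → p ∈ₗ P × a ∈ₗ vs p
  heavy-pair {a} {b} a≢b h with ∈-pairs⁺ (∈-allFin a) (∈-allFin b) a≢b
  ... | inj₁ p∈ = (a , b) , ∈-filter⁺ (heavy? ∘ vs) p∈ h , here refl
  ... | inj₂ p∈ = (b , a) , ∈-filter⁺ (heavy? ∘ vs) p∈ (heavy-resp vs-swap vs-swap h) , there (here refl)

  -- If the other vertex of the pair were missing, `f` would meet a heavy set in a single vertex.
  closed : ∀ {p f x} → p ∈ₗ P → f ∈ₗ E → x ∈ₗ vs p → x ∈ f → All (_∈ f) (vs p)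
  closed {a , b} {f} p∈ f∈ (here refl) x∈f with b ∈? f
  ... | yes b∈f = x∈f ∷ b∈f ∷ []
  ... | no b∉f = contradiction {A = Empty.⊥} (heavy-no-single (P-heavy p∈) (here refl) f∈ x∈f
          λ { (here p) _ → p ; (there (here refl)) b∈f → contradiction b∈f b∉f }) λ ()
  closed {a , b} {f} p∈ f∈ (there (here refl)) x∈f with a ∈? f
  ... | yes a∈f = a∈f ∷ x∈f ∷ []
  ... | no a∉f = contradiction {A = Empty.⊥} (heavy-no-single (P-heavy p∈) (there (here refl)) f∈ x∈f
          λ { (here refl) a∈f → contradiction a∈f a∉f ; (there (here p)) _ → p }) λ ()

  -- An edge through the kernel S that avoids a vertex y outside S avoids the whole heavy pair of y.
  heavy-contains-pair : ∀ {S p x} → Heavy S → p ∈ₗ P → x ∈ₗ vs p → x ∈ₗ S → vs p ⊆ₗ S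
  heavy-contains-pair {S} {p} {x} h p∈ x∈p x∈S {y} y∈p
    with (e , e∈ , S⊆e , av) ← heavy-avoid h (y ∷ y ∷ y ∷ []) refl
    = All.lookup av (here refl) (All.lookup (closed p∈ e∈ x∈p (All.lookup S⊆e x∈S)) y∈p)

  -- One shared vertex already puts all of `p` inside `q`, by `heavy-contains-pair`; the increasing
  -- order then gives equality.
  P-disjoint : ∀ {p q x} → p ∈ₗ P → q ∈ₗ P → x ∈ₗ vs p → x ∈ₗ vs q → p ≡ q
  P-disjoint {p} {q} p∈ q∈ x∈p x∈q = sorted-pair-≡ (P-sorted p∈) (P-sorted q∈) (p⊆q (here refl)) (p⊆q (there (here refl)))
    where
    p⊆q : vs p ⊆ₗ vs q
    p⊆q = heavy-contains-pair (P-heavy q∈) p∈ x∈p x∈q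

  paired : List (Fin n)
  paired = concatMap vs P

  ∈-paired⁻ : ∀ {x} → x ∈ₗ paired → ∃ λ p → p ∈ₗ P × x ∈ₗ vs p
  ∈-paired⁻ = find ∘ ∈-concatMap⁻ vs

  unpaired : List (Fin n)
  unpaired = filter (λ x → ¬? (x ∈ₗ? paired)) (allFin n)

  ∈-unpaired⁺ : ∀ {x} → x ∉ₗ paired → x ∈ₗ unpaired
  ∈-unpaired⁺ {x} x∉ = ∈-filter⁺ (λ x → ¬? (x ∈ₗ? paired)) (∈-allFin x) x∉

  ∈-unpaired⁻ : ∀ {x} → x ∈ₗ unpaired → x ∉ₗ paired
  ∈-unpaired⁻ = proj₂ ∘ ∈-filter⁻ (λ x → ¬? (x ∈ₗ? paired)) {xs = allFin n}

  unique-unpaired : Unique unpaired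
  unique-unpaired = Unique.filter⁺ (λ x → ¬? (x ∈ₗ? paired)) (Unique.allFin⁺ n)

  unique-P : Unique P
  unique-P = Unique.filter⁺ (heavy? ∘ vs) (unique-pairs (Unique.allFin⁺ n))

  length-paired+unpaired : length paired + length unpaired ≤ n
  length-paired+unpaired = begin
    length paired + length unpaired ≡⟨ length-++ paired ⟨
    length (paired ++ unpaired)     ≤⟨ unique-⊆-length
                              (Unique.++⁺ (unique-concatMap unique-vs P-disjoint unique-P) unique-unpaired
                                λ (p , q) → ∈-unpaired⁻ q p)
                              (λ {x} _ → ∈-allFin x) ⟩
    length (allFin n)    ≡⟨ length-tabulate id ⟩
    n ∎
    where open ≤-Reasoning

  length-paired : length paired ≡ 2 * length P
  length-paired = go P
    where
    go : ∀ ps → length (concatMap vs ps) ≡ 2 * length ps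
    go [] = refl
    go (p ∷ ps) = trans (cong (2 +_) (go ps)) (sym (*-suc 2 (length ps)))

  -- Good and bad vertices

  good? : ∀ p x → Dec (Heavy (x ∷ vs p))
  good? p x = heavy? (x ∷ vs p)

  good : Fin n × Fin n → List (Fin n)
  good p = filter (good? p) unpaired

  bad? : ∀ x → Dec (¬ Any (λ p → Heavy (x ∷ vs p)) P)
  bad? x = ¬? (Any.any? (λ p → good? p x) P)

  bad : List (Fin n)
  bad = filter bad? unpaired

  -- If `p` and `q` are disjoint, an edge through `x` and `p` that avoids the vertices of `q` meets
  -- the heavy set `x ∷ vs q` in `x` alone.
  good-disjoint : ∀ {p q x} → p ∈ₗ P → q ∈ₗ P → x ∈ₗ good p → x ∈ₗ good q → p ≡ q
  good-disjoint {p} {q} {x} p∈ q∈ x∈p x∈q with Any.any? (_∈ₗ? vs p) (vs q)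
  ... | yes y∈ = let (y , y∈q , y∈p) = find y∈ in P-disjoint p∈ q∈ y∈p y∈q
  ... | no disj
    with (x∈unpaired , hp) ← ∈-filter⁻ (good? p) {xs = unpaired} x∈p
    with (_ , hq) ← ∈-filter⁻ (good? q) {xs = unpaired} x∈q
    -- Only two vertices need avoiding; the second is repeated to fill the third place in `Heavy`.
    with (e , e∈ , (x∈e ∷ p⊆e) , av) ← heavy-avoid hp (proj₁ q ∷ proj₂ q ∷ proj₂ q ∷ []) refl
    = contradiction (heavy-no-single hq (here refl) e∈ x∈e λ
        { (here p) _ → p
        ; (there (here refl)) s∈e → outside-p (here refl) (All.lookup av (here refl) s∈e)
        ; (there (there (here refl))) s∈e → outside-p (there (here refl)) (All.lookup av (there (here refl)) s∈e) })
        λ ()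
    where
    outside-p : ∀ {s} → s ∈ₗ vs q → s ∈ₗ x ∷ vs p → s ≡ x
    outside-p s∈q (here s≡x) = s≡x
    outside-p s∈q (there s∈p) = contradiction (lose s∈q s∈p) disj

  length-good+bad : length (concatMap good P) + length bad ≤ length unpaired
  length-good+bad = begin
    length (concatMap good P) + length bad ≡⟨ length-++ (concatMap good P) ⟨
    length (concatMap good P ++ bad)       ≤⟨ unique-⊆-length
       (Unique.++⁺ (unique-concatMap (λ {p} _ → Unique.filter⁺ (good? p) unique-unpaired) good-disjoint unique-P)
          (Unique.filter⁺ bad? unique-unpaired) disj) sub ⟩
    length unpaired ∎
    where
    open ≤-Reasoning
    disj : ∀ {x} → ¬ (x ∈ₗ concatMap good P × x ∈ₗ bad)
    disj {x} (x∈g , x∈b) with find (∈-concatMap⁻ good {xs = P} x∈g)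
    ... | p , p∈ , x∈p = proj₂ (∈-filter⁻ bad? {xs = unpaired} x∈b) (lose p∈ (proj₂ (∈-filter⁻ (good? p) {xs = unpaired} x∈p)))
    sub : concatMap good P ++ bad ⊆ₗ unpaired
    sub x∈ with ∈-++⁻ (concatMap good P) x∈
    ... | inj₂ x∈b = proj₁ (∈-filter⁻ bad? x∈b)
    ... | inj₁ x∈g with find (∈-concatMap⁻ good {xs = P} x∈g)
    ...   | p , _ , x∈p = proj₁ (∈-filter⁻ (good? p) x∈p)

  -- Candidate edges of the three kinds

  blocks : List (Subset n)
  blocks = map (λ (p , q) → ⟦ vs p ++ vs q ⟧) (pairs P)

  incident : Fin n × Fin n → List (Subset n)
  incident p = filter (proj₁ p ∈?_) E

  goodPairs : Fin n × Fin n → List (Subset n)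
  goodPairs p = map (λ (x , y) → ⟦ x ∷ y ∷ vs p ⟧) (pairs (good p))

  -- Every edge made of p and two vertices good for p occurs in both lists, so the shorter one covers
  -- them all: this bounds their number by the maximum degree and by a binomial coefficient at once.
  star : Fin n × Fin n → List (Subset n)
  star p = shorter (incident p) (goodPairs p)

  -- At most 3 · 3 · 6 candidates for the edges charged to x, found by branching over covers.
  charges : Fin n → List (Subset n)
  charges x =
    concatMap (λ a →
    concatMap (λ b →
      map (λ c → ⟦ c ∷ b ∷ a ∷ x ∷ [] ⟧) (cover (b ∷ a ∷ x ∷ []) ++ cover (b ∷ a ∷ [])))
      (cover (a ∷ x ∷ [])))
      (cover (x ∷ []))

  charged : List (Subset n)
  charged = concatMap charges bad

  length-charges : ∀ x → length (charges x) ≤ 54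
  length-charges x = via (x ∷ []) λ a → via (a ∷ x ∷ []) λ b → begin
    length (map (λ c → ⟦ c ∷ b ∷ a ∷ x ∷ [] ⟧) (cover (b ∷ a ∷ x ∷ []) ++ cover (b ∷ a ∷ [])))
                                                      ≡⟨ length-map _ (cover (b ∷ a ∷ x ∷ []) ++ _) ⟩
    length (cover (b ∷ a ∷ x ∷ []) ++ cover (b ∷ a ∷ []))
                                                      ≡⟨ length-++ (cover (b ∷ a ∷ x ∷ [])) ⟩
    length (cover (b ∷ a ∷ x ∷ [])) + length (cover (b ∷ a ∷ []))
                                                      ≤⟨ +-mono-≤ (proj₁ (cover-spec _)) (proj₁ (cover-spec _)) ⟩
    6 ∎
    where
    open ≤-Reasoning
    via : ∀ S {f : Fin n → List (Subset n)} {k} → (∀ a → length (f a) ≤ k) →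
          length (concatMap f (cover S)) ≤ 3 * k
    via S {f} {k} f≤ = ≤-trans (concatMap-length-≤ k f f≤ (cover S)) (*-monoˡ-≤ k (proj₁ (cover-spec S)))

  -- Charging edges to bad vertices

  one-light : ∀ {e x} → e ∈ₗ E → x ∈ e → ¬ Heavy (x ∷ [])
  one-light e∈ x∈e h = heavy-no-single h (here refl) e∈ x∈e λ { (here p) _ → p }

  pair-light : ∀ {a b} → a ∉ₗ paired → b ≢ a → ¬ Heavy (b ∷ a ∷ [])
  pair-light {a} {b} a∉ b≢a h =
    let (p , p∈ , a∈p) = heavy-pair (≢-sym b≢a) (heavy-resp vs-swap vs-swap h) in a∉ (∈-concatMap p∈ a∈p)

  ∷-unique : ∀ {x} {xs : List (Fin n)} → x ∉ₗ xs → Unique xs → Unique (x ∷ xs)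
  ∷-unique x∉ u = All.¬Any⇒All¬ _ x∉ ∷ u

  unique⁴ : ∀ {a b c x : Fin n} → a ∉ₗ x ∷ [] → b ∉ₗ a ∷ x ∷ [] → c ∉ₗ b ∷ a ∷ x ∷ [] → Unique (c ∷ b ∷ a ∷ x ∷ [])
  unique⁴ a∉ b∉ c∉ = ∷-unique c∉ (∷-unique b∉ (∷-unique a∉ ([] ∷ [])))

  ∣e∣≤4 : ∀ {e} → e ∈ₗ E → ∣ e ∣ ≤ 4
  ∣e∣≤4 = ≤-reflexive ∘ size

  fresh-in : ∀ {e} → e ∈ₗ E → (xs : List (Fin n)) → length xs < 4 → ∃ λ y → y ∈ e × y ∉ₗ xs
  fresh-in e∈ xs lt = fresh xs (subst (_ <_) (sym (size e∈)) lt)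

  -- First way to bound the last branching: the fourth vertex comes from the cover of the triple
  -- already chosen.
  LightTriples : Subset n → Fin n → Set
  LightTriples e x = ∀ {a b} → a ∈ e → b ∈ e → a ∉ₗ x ∷ [] → b ∉ₗ a ∷ x ∷ [] → ¬ Heavy (b ∷ a ∷ x ∷ [])

  -- Second way: the edge without `x` is heavy, stated for every order in which branching may reach
  -- its vertices. The fourth vertex then lies in the cover of the light pair, by
  -- `heavy-extends-into-cover`.
  HeavyRest : Subset n → Fin n → Set
  HeavyRest e x = ∀ {a b} → a ∈ e → b ∈ e → a ∉ₗ x ∷ [] → b ∉ₗ a ∷ x ∷ [] →
    ¬ Heavy (b ∷ a ∷ []) × (∀ {c} → c ∈ e → c ∉ₗ b ∷ a ∷ x ∷ [] → Heavy (b ∷ a ∷ c ∷ []))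

  -- The set `x ∷ []` is light because an edge contains `x`, and pairs through `x` are light because
  -- `x` is unpaired, so covers supply `a` and `b`. The two cases differ only in how `last` finds
  -- the fourth vertex.
  charge : ∀ {e x} → e ∈ₗ E → x ∈ e → x ∈ₗ bad → LightTriples e x ⊎ HeavyRest e x → e ∈ₗ charged
  charge {e} {x} e∈ x∈e x∈bad cases = choose₁ (cover-hits (one-light e∈ x∈e) e∈ (x∈e ∷ []))
    where
    x∉paired : x ∉ₗ paired
    x∉paired = ∈-unpaired⁻ (proj₁ (∈-filter⁻ bad? {xs = unpaired} x∈bad))

    Chosen : List (Fin n) → Fin n → List (Fin n) → Set
    Chosen W c S = c ∈ₗ W × c ∈ e × c ∉ₗ S

    last : ∀ {a b} → a ∈ e → b ∈ e → a ∉ₗ x ∷ [] → b ∉ₗ a ∷ x ∷ [] → LightTriples e x ⊎ HeavyRest e x →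
      ∃ λ c → Chosen (cover (b ∷ a ∷ x ∷ []) ++ cover (b ∷ a ∷ [])) c (b ∷ a ∷ x ∷ [])
    last {a} {b} a∈e b∈e a∉ b∉ (inj₁ light) with cover-hits (light a∈e b∈e a∉ b∉) e∈ (b∈e ∷ a∈e ∷ x∈e ∷ [])
    ... | c , c∈c , c∈e , c∉ = c , ∈-++⁺ˡ c∈c , c∈e , c∉
    last {a} {b} a∈e b∈e a∉ b∉ (inj₂ rest) with fresh-in e∈ (b ∷ a ∷ x ∷ []) ≤-refl | rest a∈e b∈e a∉ b∉
    ... | c , c∈e , c∉ | light , heavy =
      c , ∈-++⁺ʳ (cover (b ∷ a ∷ x ∷ [])) (heavy-extends-into-cover light (heavy c∈e c∉)) , c∈e , c∉

    choose₃ : ∀ {a b} → Chosen (cover (x ∷ [])) a (x ∷ []) → Chosen (cover (a ∷ x ∷ [])) b (a ∷ x ∷ []) →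
      (∃ λ c → Chosen (cover (b ∷ a ∷ x ∷ []) ++ cover (b ∷ a ∷ [])) c (b ∷ a ∷ x ∷ [])) → e ∈ₗ charged
    choose₃ (a∈c , a∈e , a∉) (b∈c , b∈e , b∉) (c , c∈c , c∈e , c∉) =
      ∈-concatMap x∈bad (∈-concatMap a∈c (∈-concatMap b∈c
         (subst (_∈ₗ _) (sym (≡⟦⟧ (unique⁴ a∉ b∉ c∉) (c∈e ∷ b∈e ∷ a∈e ∷ x∈e ∷ []) (∣e∣≤4 e∈)))
           (∈-map⁺ _ c∈c))))

    choose₂ : ∀ {a} → Chosen (cover (x ∷ [])) a (x ∷ []) →
      (∃ λ b → Chosen (cover (a ∷ x ∷ [])) b (a ∷ x ∷ [])) → e ∈ₗ charged
    choose₂ ca@(_ , a∈e , a∉) (b , cb@(_ , b∈e , b∉)) = choose₃ ca cb (last a∈e b∈e a∉ b∉ cases)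

    choose₁ : (∃ λ a → Chosen (cover (x ∷ [])) a (x ∷ [])) → e ∈ₗ charged
    choose₁ (a , ca@(_ , a∈e , a∉)) =
      choose₂ ca (cover-hits (pair-light x∉paired (a∉ ∘ here)) e∈ (a∈e ∷ x∈e ∷ []))

  two-in-unpaired : ∀ {x y} → x ∈ₗ unpaired → y ∈ₗ unpaired → x ≢ y → 2 ≤ length unpaired
  two-in-unpaired x∈ y∈ x≢y = unique-⊆-length ((x≢y ∷ []) ∷ [] ∷ []) λ { (here refl) → x∈ ; (there (here refl)) → y∈ }

  -- The second component rules this kind out when at most one vertex is unpaired.
  Charged : Subset n → Set
  Charged e = e ∈ₗ charged × 2 ≤ length unpaired

  -- Every vertex of `e` is bad, because a heavy `z ∷ vs q` would meet `e` in `z` alone. If the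
  -- other three vertices of some `x` in `e` form a heavy set, `e` is charged to `x`; if this never
  -- happens, any vertex will do.
  charge-without-pairs : ∀ {e} → e ∈ₗ E → (∀ {z} → z ∈ e → z ∉ₗ paired) → Charged e
  charge-without-pairs {e} e∈ e∉paired =
    charged-by (Any.any? (heavy? ∘ others) (elements e)) ,
    (let (x , x∈e , _) = fresh-in e∈ [] (s≤s z≤n)
         (y , y∈e , y∉) = fresh-in e∈ (x ∷ []) (s≤s (s≤s z≤n))
     in two-in-unpaired (∈-unpaired⁺ (e∉paired x∈e)) (∈-unpaired⁺ (e∉paired y∈e)) (y∉ ∘ here ∘ sym))
    where
    others : Fin n → List (Fin n)
    others z = filter (λ y → ¬? (y Fin.≟ z)) (elements e)

    ∈-others⁺ : ∀ {y z} → y ∈ e → y ≢ z → y ∈ₗ others z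
    ∈-others⁺ {z = z} y∈ = ∈-filter⁺ (λ y → ¬? (y Fin.≟ z)) (∈-elements⁺ y∈)

    ∈-others⁻ : ∀ {y z} → y ∈ₗ others z → y ∈ e × y ≢ z
    ∈-others⁻ {z = z} y∈ = let (p , q) = ∈-filter⁻ (λ y → ¬? (y Fin.≟ z)) {xs = elements e} y∈ in ∈-elements⁻ p , q

    is-bad : ∀ {z} → z ∈ e → z ∈ₗ bad
    is-bad {z} z∈e = ∈-filter⁺ bad? (∈-unpaired⁺ (e∉paired z∈e)) λ z-good →
      let (q , q∈ , h) = find z-good in
      heavy-no-single h (here refl) e∈ z∈e λ
        { (here p) _ → p ; (there s∈q) s∈e → contradiction (∈-concatMap q∈ s∈q) (e∉paired s∈e) }

    charged-by : Dec (Any (Heavy ∘ others) (elements e)) → e ∈ₗ charged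
    charged-by (yes some) = let (x , x∈ , h) = find some ; x∈e = ∈-elements⁻ x∈ in
      charge e∈ x∈e (is-bad x∈e) (inj₂ λ {a} {b} a∈e b∈e a∉ b∉ →
        pair-light (e∉paired a∈e) (b∉ ∘ here) , λ {c} c∈e c∉ → heavy-resp
          (λ y∈ → let (y∈e , y≢x) = ∈-others⁻ y∈ in
            drop-last y≢x (exhaust (unique⁴ a∉ b∉ c∉) (c∈e ∷ b∈e ∷ a∈e ∷ x∈e ∷ []) (∣e∣≤4 e∈) y∈e))
          (λ { (here refl) → ∈-others⁺ b∈e (b∉ ∘ there ∘ here)
             ; (there (here refl)) → ∈-others⁺ a∈e (a∉ ∘ here)
             ; (there (there (here refl))) → ∈-others⁺ c∈e (c∉ ∘ there ∘ there ∘ here) }) h)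
      where
      drop-last : ∀ {a b c x y : Fin n} → y ≢ x → y ∈ₗ c ∷ b ∷ a ∷ x ∷ [] → y ∈ₗ b ∷ a ∷ c ∷ []
      drop-last y≢x (here p) = there (there (here p))
      drop-last y≢x (there (here p)) = here p
      drop-last y≢x (there (there (here p))) = there (here p)
      drop-last y≢x (there (there (there (here p)))) = contradiction p y≢x
    -- A heavy triple `b ∷ a ∷ x ∷ []` would be the rest of `e` beside its fourth vertex `d`,
    -- against `none`.
    charged-by (no none) = let (x , x∈e , _) = fresh-in e∈ [] (s≤s z≤n) in
      charge e∈ x∈e (is-bad x∈e) (inj₁ λ {a} {b} a∈e b∈e a∉ b∉ h →
        let (d , d∈e , d∉) = fresh-in e∈ (b ∷ a ∷ x ∷ []) ≤-refl
            bax⊆e = b∈e ∷ a∈e ∷ x∈e ∷ []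
        in none (lose (∈-elements⁺ d∈e) (heavy-resp
          (λ y∈ → ∈-others⁺ (All.lookup bax⊆e y∈) λ { refl → d∉ y∈ })
          (λ y∈ → let (y∈e , y≢d) = ∈-others⁻ y∈ in
            Any.tail y≢d (exhaust (unique⁴ a∉ b∉ d∉) (d∈e ∷ bax⊆e) (∣e∣≤4 e∈) y∈e)) h)))

  -- Classification of the edges

  Classified : Subset n → Set
  Classified e = e ∈ₗ blocks ++ concatMap star P ⊎ Charged e

  module WithPair {e p} (e∈ : e ∈ₗ E) (p∈ : p ∈ₗ P) (p⊆e : All (_∈ e) (vs p)) where

    -- `closed` brings the whole heavy pair of `z` into `e`, and two disjoint pairs exhaust its four
    -- vertices.
    block : ∀ {z} → z ∈ e → z ∈ₗ paired → z ∉ₗ vs p → e ∈ₗ blocks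
    block {z} z∈e z∈paired z∉p =
      let (q , q∈ , z∈q) = ∈-paired⁻ z∈paired
          p≢q : p ≢ q
          p≢q = λ { refl → z∉p z∈q }
          q⊆e = closed q∈ e∈ z∈q z∈e
      in [ (λ pq∈ → subst (_∈ₗ blocks) (sym (≡⟦⟧
               (Unique.++⁺ (unique-vs p∈) (unique-vs q∈) λ (x∈p , x∈q) → p≢q (P-disjoint p∈ q∈ x∈p x∈q))
               (All.++⁺ p⊆e q⊆e) (∣e∣≤4 e∈))) (∈-map⁺ _ pq∈))
         , (λ qp∈ → subst (_∈ₗ blocks) (sym (≡⟦⟧
               (Unique.++⁺ (unique-vs q∈) (unique-vs p∈) λ (x∈q , x∈p) → p≢q (P-disjoint p∈ q∈ x∈p x∈q))
               (All.++⁺ q⊆e p⊆e) (∣e∣≤4 e∈))) (∈-map⁺ _ qp∈))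
         ]′ (∈-pairs⁺ p∈ q∈ p≢q)

    module _ (no-other : ∀ {z} → z ∈ e → z ∉ₗ vs p → z ∉ₗ paired) where

      -- `z` is bad: a heavy pair for which it is good would have to meet `e` outside `z`, hence be
      -- `p`, against lightness of `z ∷ vs p`.
      charge-outside : ∀ {z} → z ∈ e → z ∉ₗ vs p → ¬ Heavy (z ∷ vs p) → e ∈ₗ charged
      charge-outside {z} z∈e z∉p light =
        charge e∈ z∈e (∈-filter⁺ bad? (∈-unpaired⁺ (no-other z∈e z∉p)) λ z-good →
            let (q , q∈ , h) = find z-good in
            heavy-no-single h (here refl) e∈ z∈e λ
              { (here s≡z) _ → s≡z
              ; (there s∈q) s∈e → contradiction (subst (λ q → Heavy (z ∷ vs q)) (same q∈ s∈q s∈e) h) light })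
          (inj₁ light-triples)
        where
        same : ∀ {q s} → q ∈ₗ P → s ∈ₗ vs q → s ∈ e → q ≡ p
        same {q} {s} q∈ s∈q s∈e with s ∈ₗ? vs p
        ... | yes s∈p = P-disjoint q∈ p∈ s∈q s∈p
        ... | no s∉p = contradiction (∈-concatMap q∈ s∈q) (no-other s∈e s∉p)

        drop-z : ∀ {a b y} → y ∈ₗ vs p → y ∈ₗ b ∷ a ∷ z ∷ [] → y ∈ₗ b ∷ a ∷ []
        drop-z y∈p (here q) = here q
        drop-z y∈p (there (here q)) = there (here q)
        drop-z y∈p (there (there (here refl))) = contradiction y∈p z∉p

        reverse-⊆ : ∀ {a b} → proj₁ p ∈ₗ b ∷ a ∷ [] → proj₂ p ∈ₗ b ∷ a ∷ [] → b ∷ a ∷ z ∷ [] ⊆ₗ z ∷ vs p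
        reverse-⊆ _ _ (there (there (here q))) = here q
        reverse-⊆ (here p₁) (there (here p₂)) (here q) = there (here (trans q (sym p₁)))
        reverse-⊆ (here p₁) (there (here p₂)) (there (here q)) = there (there (here (trans q (sym p₂))))
        reverse-⊆ (there (here p₁)) (here p₂) (here q) = there (there (here (trans q (sym p₂))))
        reverse-⊆ (there (here p₁)) (here p₂) (there (here q)) = there (here (trans q (sym p₁)))
        reverse-⊆ (here p₁) (here p₂) _ = contradiction (trans p₁ (sym p₂)) (Fin.<⇒≢ (P-sorted p∈))
        reverse-⊆ (there (here p₁)) (there (here p₂)) _ = contradiction (trans p₁ (sym p₂)) (Fin.<⇒≢ (P-sorted p∈))

        -- A heavy triple meeting `p` contains `p` and so equals the light set `z ∷ vs p`; a triple
        -- disjoint from `p` would give `e` five vertices.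
        light-triples : LightTriples e z
        light-triples {a} {b} a∈e b∈e a∉ b∉ h with Any.any? (_∈ₗ? b ∷ a ∷ z ∷ []) (vs p)
        ... | yes some = let (y , y∈p , y∈S) = find some
                             p⊆S : vs p ⊆ₗ b ∷ a ∷ z ∷ []
                             p⊆S = heavy-contains-pair h p∈ y∈p y∈S
          in light (heavy-resp
               (reverse-⊆ (drop-z (here refl) (p⊆S (here refl))) (drop-z (there (here refl)) (p⊆S (there (here refl)))))
               (λ { (here q) → there (there (here q)) ; (there y∈) → p⊆S y∈ }) h)
        ... | no none = contradiction
               (≤-trans (⊆-∣∣ (Unique.++⁺ (unique-vs p∈) (∷-unique b∉ (∷-unique a∉ ([] ∷ [])))
                                  λ (y∈p , y∈S) → none (lose y∈p y∈S))
                              (All.++⁺ p⊆e (b∈e ∷ a∈e ∷ z∈e ∷ [])))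
                        (∣e∣≤4 e∈))
               λ { (s≤s (s≤s (s≤s (s≤s ())))) }

      good-star : ∀ {x y} → x ∈ e → y ∈ e → x ∉ₗ vs p → y ∉ₗ x ∷ vs p →
        Heavy (x ∷ vs p) → Heavy (y ∷ vs p) → e ∈ₗ star p
      good-star {x} {y} x∈e y∈e x∉ y∉ hx hy =
        ∈-shorter (∈-filter⁺ (proj₁ p ∈?_) e∈ (All.head p⊆e))
          ([ (λ xy∈ → subst (_∈ₗ goodPairs p) (sym (≡⟦⟧
                 (∷-unique (λ { (here q) → y∉ (here (sym q)) ; (there q) → x∉ q }) (∷-unique (y∉ ∘ there) (unique-vs p∈)))
                 (x∈e ∷ y∈e ∷ p⊆e) (∣e∣≤4 e∈))) (∈-map⁺ _ xy∈))
           , (λ yx∈ → subst (_∈ₗ goodPairs p) (sym (≡⟦⟧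
                 (∷-unique y∉ (∷-unique x∉ (unique-vs p∈)))
                 (y∈e ∷ x∈e ∷ p⊆e) (∣e∣≤4 e∈))) (∈-map⁺ _ yx∈))
           ]′ (∈-pairs⁺ (∈-filter⁺ (good? p) (∈-unpaired⁺ (no-other x∈e x∉)) hx)
                        (∈-filter⁺ (good? p) (∈-unpaired⁺ (no-other y∈e (y∉ ∘ there))) hy) (y∉ ∘ here ∘ sym)))

      classify-outside : Classified e
      classify-outside =
        let (x , x∈e , x∉) = fresh-in e∈ (vs p) (s≤s (s≤s (s≤s z≤n)))
            (y , y∈e , y∉) = fresh-in e∈ (x ∷ vs p) ≤-refl
            two-unpaired = two-in-unpaired (∈-unpaired⁺ (no-other x∈e x∉)) (∈-unpaired⁺ (no-other y∈e (y∉ ∘ there))) (y∉ ∘ here ∘ sym)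
        in decide x∈e y∈e x∉ y∉ two-unpaired (good? p x) (good? p y)
        where
        decide : ∀ {x y} → x ∈ e → y ∈ e → x ∉ₗ vs p → y ∉ₗ x ∷ vs p → 2 ≤ length unpaired →
          Dec (Heavy (x ∷ vs p)) → Dec (Heavy (y ∷ vs p)) → Classified e
        decide x∈e y∈e x∉ y∉ _ (yes hx) (yes hy) =
          inj₁ (∈-++⁺ʳ blocks (∈-concatMap p∈ (good-star x∈e y∈e x∉ y∉ hx hy)))
        -- A vertex of `e` outside `p` that is not good for `p` takes the charge.
        decide x∈e y∈e x∉ y∉ two-unpaired (no lx) _       = inj₂ (charge-outside x∈e x∉ lx , two-unpaired)
        decide x∈e y∈e x∉ y∉ two-unpaired (yes _) (no ly) = inj₂ (charge-outside y∈e (y∉ ∘ there) ly , two-unpaired)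

  classify : ∀ {e} → e ∈ₗ E → Classified e
  classify {e} e∈ with Any.any? (λ p → All.all? (_∈? e) (vs p)) P
  ... | no none = inj₂ (charge-without-pairs e∈ λ z∈e z∈paired →
          let (p , p∈ , z∈p) = ∈-paired⁻ z∈paired in none (lose p∈ (closed p∈ e∈ z∈p z∈e)))
  ... | yes some = let (p , p∈ , p⊆e) = find some in with-pair p∈ p⊆e
    where
    with-pair : ∀ {p} → p ∈ₗ P → All (_∈ e) (vs p) → Classified e
    with-pair {p} p∈ p⊆e with Any.any? (λ z → z ∈ₗ? paired ×-dec ¬? (z ∈ₗ? vs p)) (elements e)
    ... | yes some = let (z , z∈ , z∈paired , z∉p) = find some in
            inj₁ (∈-++⁺ˡ (WithPair.block e∈ p∈ p⊆e (∈-elements⁻ z∈) z∈paired z∉p))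
    ... | no none = WithPair.classify-outside e∈ p∈ p⊆e λ z∈e z∉p z∈paired → none (lose (∈-elements⁺ z∈e) (z∈paired , z∉p))

  -- Bounds on the number of edges

  length-blocks : length blocks ≡ length P C 2
  length-blocks = trans (length-map _ (pairs P)) (length-pairs P)

  length-goodPairs : ∀ p → length (goodPairs p) ≡ length (good p) C 2
  length-goodPairs p = trans (length-map _ (pairs (good p))) (length-pairs (good p))

  star≤maxDegree : ∀ p → length (star p) ≤ maxDegree H
  star≤maxDegree p = ≤-trans (shorter-≤ˡ (incident p) (goodPairs p)) (degree≤maxDegree H (proj₁ p))

  star≤goodPairs : ∀ p → length (star p) ≤ length (good p) C 2
  star≤goodPairs p = ≤-trans (shorter-≤ʳ (incident p) (goodPairs p)) (≤-reflexive (length-goodPairs p))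

  -- With at most one unpaired vertex nothing is charged, and no heavy pair has two good vertices,
  -- so all stars are empty.
  numEdges-≤-small : length unpaired < 2 → numEdges H ≤ length P C 2
  numEdges-≤-small small = begin
    numEdges H                              ≤⟨ unique-⊆-length (distinct H) sub ⟩
    length (blocks ++ concatMap star P)     ≡⟨ length-++ blocks ⟩
    length blocks + length (concatMap star P) ≤⟨ +-mono-≤ (≤-reflexive length-blocks) stars≤0 ⟩
    length P C 2 + length P * 0             ≡⟨ cong (length P C 2 +_) (*-zeroʳ (length P)) ⟩
    length P C 2 + 0                        ≡⟨ +-identityʳ _ ⟩
    length P C 2 ∎
    where
    open ≤-Reasoning
    sub : E ⊆ₗ blocks ++ concatMap star P
    sub e∈ = [ id , (λ (_ , big) → contradiction big (<⇒≱ small)) ]′ (classify e∈)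
    stars≤0 : length (concatMap star P) ≤ length P * 0
    stars≤0 = concatMap-length-≤ 0 star
      (λ p → ≤-trans (star≤goodPairs p) (C2-mono (≤-trans (length-filter (good? p) unpaired) (s≤s⁻¹ small)))) P

  numEdges-≤ : numEdges H ≤ length P C 2 + (length (concatMap star P) + length bad * 54)
  numEdges-≤ = begin
    numEdges H                                            ≤⟨ unique-⊆-length (distinct H) sub ⟩
    length (blocks ++ (concatMap star P ++ charged))      ≡⟨ length-++ blocks ⟩
    length blocks + length (concatMap star P ++ charged)  ≡⟨ cong₂ _+_ length-blocks (length-++ (concatMap star P)) ⟩
    length P C 2 + (length (concatMap star P) + length charged)
      ≤⟨ +-monoʳ-≤ (length P C 2) (+-monoʳ-≤ (length (concatMap star P)) (concatMap-length-≤ 54 charges length-charges bad)) ⟩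
    length P C 2 + (length (concatMap star P) + length bad * 54) ∎
    where
    open ≤-Reasoning
    sub : E ⊆ₗ blocks ++ (concatMap star P ++ charged)
    sub e∈ with classify e∈
    ... | inj₂ (c , _) = ∈-++⁺ʳ blocks (∈-++⁺ʳ (concatMap star P) c)
    ... | inj₁ c with ∈-++⁻ blocks c
    ...   | inj₁ b = ∈-++⁺ˡ b
    ...   | inj₂ s = ∈-++⁺ʳ blocks (∈-++⁺ˡ s)

  stars-≤ : ∀ t → 32 * maxDegree H ≤ t * t → 8 * length (concatMap star P) ≤ t * length (concatMap good P)
  stars-≤ t Δ≤ = concatMap-length-ratio 8 t star good
    (λ p → geometric-mean t (maxDegree H) (star≤maxDegree p) (star≤goodPairs p) Δ≤) P

-- The extremal graph on disjoint blocks

module Blocks {n N : ℕ} (l r : Fin N → Fin n)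
  (l≢r : ∀ i → l i ≢ r i)
  (block-injective : ∀ {i j x} → x ∈ₗ l i ∷ r i ∷ [] → x ∈ₗ l j ∷ r j ∷ [] → i ≡ j) where

  block : Fin N → List (Fin n)
  block i = l i ∷ r i ∷ []

  union : Fin N × Fin N → Subset n
  union (i , j) = ⟦ block i ++ block j ⟧

  ∈-union⁻ : ∀ i j {x} → x ∈ union (i , j) → ∃ λ k → k ∈ₗ i ∷ j ∷ [] × x ∈ₗ block k
  ∈-union⁻ i j x∈ with ∈-++⁻ (block i) (∈-⟦⟧⁻ (block i ++ block j) x∈)
  ... | inj₁ x∈i = i , here refl , x∈i
  ... | inj₂ x∈j = j , there (here refl) , x∈j

  ∈-union⁺ : ∀ i j {k x} → k ∈ₗ i ∷ j ∷ [] → x ∈ₗ block k → x ∈ union (i , j)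
  ∈-union⁺ i j (here refl) x∈ = ∈-⟦⟧⁺ {xs = block i ++ block j} (∈-++⁺ˡ x∈)
  ∈-union⁺ i j (there (here refl)) x∈ = ∈-⟦⟧⁺ {xs = block i ++ block j} (∈-++⁺ʳ (block i) x∈)

  unique-block : ∀ i → Unique (block i)
  unique-block i = (l≢r i ∷ []) ∷ [] ∷ []

  union-size : ∀ {i j} → i ≢ j → ∣ union (i , j) ∣ ≡ 4
  union-size {i} {j} i≢j = ∣⟦⟧∣ (Unique.++⁺ (unique-block i) (unique-block j) λ (p , q) → i≢j (block-injective p q))

  all-pairs : List (Fin N × Fin N)
  all-pairs = pairs (allFin N)

  all-pairs-sorted : All (λ (i , j) → i Fin.< j) all-pairs
  all-pairs-sorted = pairs-All (AllPairs.tabulate⁺-< id)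

  union-injective : ∀ {p q} → p ∈ₗ all-pairs → q ∈ₗ all-pairs → union p ≡ union q → p ≡ q
  union-injective {i , j} {i′ , j′} p∈ q∈ eq =
    sorted-pair-≡ (All.lookup all-pairs-sorted p∈) (All.lookup all-pairs-sorted q∈)
      (transfer (here refl)) (transfer (there (here refl)))
    where
    transfer : ∀ {k} → k ∈ₗ i ∷ j ∷ [] → k ∈ₗ i′ ∷ j′ ∷ []
    transfer {k} k∈ with ∈-union⁻ i′ j′ (subst (l k ∈_) eq (∈-union⁺ i j k∈ (here refl)))
    ... | k′ , k′∈ , x∈ = subst (_∈ₗ _) (block-injective x∈ (here refl)) k′∈

  graph : FourGraph n
  graph = record
    { edges    = map union all-pairs
    ; distinct = unique-map-on union-injective (unique-pairs (Unique.allFin⁺ N))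
    ; uniform  = All.map⁺ (All.map (union-size ∘ Fin.<⇒≢) all-pairs-sorted)
    }

  numEdges-graph : numEdges graph ≡ N C 2
  numEdges-graph = trans (length-map union all-pairs)
    (trans (length-pairs (allFin N)) (cong (_C 2) (length-tabulate {n = N} id)))

  -- A common vertex lies in a block of each union; disjointness makes it the same block, whose two
  -- vertices are then both common.
  union-∩-size : ∀ p q → ∣ union p ∩ union q ∣ ≢ 1
  union-∩-size (i , j) (i′ , j′) eq
    with fresh [] {union (i , j) ∩ union (i′ , j′)} (≤-reflexive (sym eq))
  ... | x , x∈ , _ with x∈p∩q⁻ (union (i , j)) (union (i′ , j′)) x∈
  ...   | x∈p , x∈q with ∈-union⁻ i j x∈p | ∈-union⁻ i′ j′ x∈q
  ...     | k , k∈p , x∈k | k′ , k∈q , x∈k′ with block-injective x∈k x∈k′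
  ...       | refl = contradiction
    (⊆-∣∣ (unique-block k) (All.tabulate λ y∈ → x∈p∩q⁺ (∈-union⁺ i j k∈p y∈ , ∈-union⁺ i′ j′ k∈q y∈)))
    (subst (λ s → ¬ 2 ≤ s) (sym eq) λ { (s≤s ()) })

  graph-free : P42-free graph
  graph-free e∈ f∈ with ∈-map⁻ union e∈ | ∈-map⁻ union f∈
  ... | p , _ , refl | q , _ , refl = union-∩-size p q

  count : Fin n → List (Subset n) → ℕ
  count v es = length (filter (v ∈?_) es)

  count-++ : ∀ v es fs → count v (es ++ fs) ≡ count v es + count v fs
  count-++ v es fs = trans (cong length (filter-++ (v ∈?_) es fs)) (length-++ (filter (v ∈?_) es))

  count-none : ∀ v {es} → All (λ e → ¬ v ∈ e) es → count v es ≡ 0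
  count-none v es∌v = cong length (filter-none (v ∈?_) es∌v)

  count-all : ∀ v {es} → All (v ∈_) es → count v es ≡ length es
  count-all v es∋v = cong length (filter-all (v ∈?_) es∋v)

  fan : Fin N → List (Fin N) → List (Subset n)
  fan i js = map (λ j → union (i , j)) js

  pairs-∷ : ∀ i js → map union (pairs (i ∷ js)) ≡ fan i js ++ map union (pairs js)
  pairs-∷ i js = trans (map-++ union (map (i ,_) js) (pairs js)) (cong (_++ _) (sym (map-∘ js)))

  ∉-union : ∀ {i j k x} → x ∈ₗ block k → i ≢ k → j ≢ k → ¬ x ∈ union (i , j)
  ∉-union {i} {j} x∈k i≢k j≢k x∈ with ∈-union⁻ i j x∈
  ... | _ , here refl , x∈i = i≢k (block-injective x∈i x∈k)
  ... | _ , there (here refl) , x∈j = j≢k (block-injective x∈j x∈k)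

  count-fan : ∀ {v k i js} → v ∈ₗ block k → Unique js → k ∈ₗ js → i ≢ k → count v (fan i js) ≡ 1
  count-fan {v} {k} {i} {j ∷ js} v∈k (j∉ ∷ u) (here refl) i≢k = begin
    count v (union (i , j) ∷ fan i js)  ≡⟨ cong length (filter-accept (v ∈?_) (∈-union⁺ i j (there (here refl)) v∈k)) ⟩
    suc (count v (fan i js))            ≡⟨ cong suc (count-none v (All.map⁺ (All.map (λ j≢ → ∉-union v∈k i≢k (≢-sym j≢)) j∉))) ⟩
    1 ∎
    where open ≡-Reasoning
  count-fan {v} {k} {i} {j ∷ js} v∈k (j∉ ∷ u) (there k∈) i≢k =
    trans (cong length (filter-reject (v ∈?_) (∉-union v∈k i≢k (All.lookup j∉ k∈))))
          (count-fan v∈k u k∈ i≢k)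

  -- Follows the recursion of `pairs`: each fan before that of `k` contributes one edge through `v`,
  -- the fan of `k` contributes all its edges, and later fans contribute none.
  count-pairs : ∀ {v k js} → v ∈ₗ block k → Unique js → k ∈ₗ js →
    count v (map union (pairs js)) ≡ length js ∸ 1
  count-pairs {v} {k} {j ∷ js} v∈k (j∉ ∷ u) (here refl) = begin
    count v (map union (pairs (j ∷ js)))                ≡⟨ cong (count v) (pairs-∷ j js) ⟩
    count v (fan j js ++ map union (pairs js))          ≡⟨ count-++ v (fan j js) _ ⟩
    count v (fan j js) + count v (map union (pairs js)) ≡⟨ cong₂ _+_
        (count-all v {fan j js} (All.map⁺ (All.tabulate λ {i} _ → ∈-union⁺ j i (here refl) v∈k)))
        (count-none v (All.map⁺ (All.tabulate λ p∈ → let (a , b) = ∈-pairs⁻ js p∈ in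
           ∉-union v∈k (≢-sym (All.lookup j∉ a)) (≢-sym (All.lookup j∉ b))))) ⟩
    length (fan j js) + 0                               ≡⟨ +-identityʳ _ ⟩
    length (fan j js)                                   ≡⟨ length-map _ js ⟩
    length js ∎
    where open ≡-Reasoning
  -- Since `k` lies in `js`, this list is nonempty and the truncated subtraction is exact.
  count-pairs {v} {k} {j ∷ js@(_ ∷ js′)} v∈k (j∉ ∷ u) (there k∈) = begin
    count v (map union (pairs (j ∷ js)))                ≡⟨ cong (count v) (pairs-∷ j js) ⟩
    count v (fan j js ++ map union (pairs js))          ≡⟨ count-++ v (fan j js) _ ⟩
    count v (fan j js) + count v (map union (pairs js)) ≡⟨ cong₂ _+_
        (count-fan v∈k u k∈ (All.lookup j∉ k∈)) (count-pairs v∈k u k∈) ⟩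
    1 + length js′ ∎
    where open ≡-Reasoning

  degree-block : ∀ {v k} → v ∈ₗ block k → degree graph v ≡ N ∸ 1
  degree-block {k = k} v∈k = trans (count-pairs v∈k (Unique.allFin⁺ N) (∈-allFin k))
    (cong (_∸ 1) (length-tabulate {n = N} id))

  degree-≤ : ∀ v → degree graph v ≤ N ∸ 1
  degree-≤ v with Fin.any? (λ k → v ∈ₗ? block k)
  ... | yes (k , v∈k) = ≤-reflexive (degree-block v∈k)
  ... | no none = subst (_≤ N ∸ 1)
    (sym (count-none v (All.map⁺ (All.universal (λ (i , j) v∈ → let (k , _ , v∈k) = ∈-union⁻ i j v∈ in none (k , v∈k)) all-pairs))))
    z≤n

  maxDegree-graph : Fin N → maxDegree graph ≡ N ∸ 1
  maxDegree-graph k = ≤-antisym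
    (foldr-⊔-≤ (All.map⁺ (All.universal degree-≤ (allFin n))))
    (subst (_≤ maxDegree graph) (degree-block (here refl)) (degree≤maxDegree graph (l k)))

-- Blocks of consecutive vertices

module PairedVertices (n : ℕ) where

  N : ℕ
  N = n / 2

  odd< : (i : Fin N) → suc (2 * toℕ i) < n
  odd< i = begin
    2 + 2 * toℕ i    ≡⟨ *-suc 2 (toℕ i) ⟨
    2 * suc (toℕ i)  ≤⟨ *-monoʳ-≤ 2 (Fin.toℕ<n i) ⟩
    2 * N            ≡⟨ *-comm 2 N ⟩
    N * 2            ≤⟨ m/n*n≤m n 2 ⟩
    n ∎
    where open ≤-Reasoning

  l r : Fin N → Fin n
  l i = fromℕ< (<⇒≤ (odd< i))
  r i = fromℕ< (odd< i)

  toℕ-l : ∀ i → toℕ (l i) ≡ 2 * toℕ i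
  toℕ-l i = Fin.toℕ-fromℕ< _

  toℕ-r : ∀ i → toℕ (r i) ≡ suc (2 * toℕ i)
  toℕ-r i = Fin.toℕ-fromℕ< _

  l≢r : ∀ i j → l i ≢ r j
  l≢r i j eq = even≢odd (toℕ i) (toℕ j) (trans (sym (toℕ-l i)) (trans (cong toℕ eq) (toℕ-r j)))

  block-injective : ∀ {i j x} → x ∈ₗ l i ∷ r i ∷ [] → x ∈ₗ l j ∷ r j ∷ [] → i ≡ j
  block-injective {i} {j} (here refl) (here eq) =
    Fin.toℕ-injective (*-cancelˡ-≡ _ _ 2 (trans (sym (toℕ-l i)) (trans (cong toℕ eq) (toℕ-l j))))
  block-injective {i} {j} (there (here refl)) (there (here eq)) =
    Fin.toℕ-injective (*-cancelˡ-≡ _ _ 2 (suc-injective (trans (sym (toℕ-r i)) (trans (cong toℕ eq) (toℕ-r j)))))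
  block-injective {i} {j} (here refl) (there (here eq)) = contradiction eq (l≢r i j)
  block-injective {i} {j} (there (here refl)) (here eq) = contradiction (sym eq) (l≢r j i)

  open Blocks l r (λ i → l≢r i i) block-injective public using (graph; graph-free; numEdges-graph; maxDegree-graph)

-- Comparison of the edge bound with the binomial coefficient

-- Here `h` counts heavy pairs, `ρ` unpaired vertices, `g` good ones, `b` bad ones and `s` star
-- edges. After scaling by 8 each good or bad vertex costs at most `t`, since 8 times 54 is 432.
count-≤-C2 : ∀ {n t h ρ g b s m} → n ≡ t + 16 → 432 ≤ t → 2 * h + ρ ≤ n → 2 ≤ ρ → g + b ≤ ρ →
  8 * s ≤ t * g → m ≤ h C 2 + (s + b * 54) → m ≤ (n / 2) C 2
count-≤-C2 {n} {t} {h} {ρ} {g} {b} {s} {m} n≡ 432≤t hρ≤n 2≤ρ gb≤ρ s≤ m≤ =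
  -- The added terms turn `h * (h ∸ 1)` into `h * h` and `t` into `n`, which leads to a polynomial
  -- inequality.
  *-cancelˡ-≤ 8 (+-cancelʳ-≤ (4 * h + 16 * ρ′) _ _ (begin
    8 * m + (4 * h + 16 * ρ′)                   ≤⟨ +-monoˡ-≤ _ 8m≤ ⟩
    4 * (h * (h ∸ 1)) + t * ρ′ + (4 * h + 16 * ρ′)
                                                ≡⟨ arith₁ (h * (h ∸ 1)) h t ρ′ ⟩
    4 * (h * (h ∸ 1) + h) + (t + 16) * ρ′       ≡⟨ cong₂ (λ x y → 4 * x + y * ρ′) (square-pred h) (sym n≡) ⟩
    4 * (h * h) + n * ρ′                        ≡⟨ cong₂ (λ x y → 4 * (h * h) + x * y) n≡ε ρ′≡ ⟩
    4 * (h * h) + (ε + 2 * (suc h + i)) * (ε + 2 * suc i)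
                                                ≤⟨ by-parity ε (m%n<n n 2) ⟩
    4 * ((suc h + i) * (h + i)) + (4 * h + 16 * (ε + 2 * suc i))
                                                ≡⟨ cong₂ (λ x y → 4 * (x * (x ∸ 1)) + (4 * h + 16 * y)) N≡ ρ′≡ ⟨
    4 * (N * (N ∸ 1)) + (4 * h + 16 * ρ′)       ≡⟨ cong (λ x → 4 * x + (4 * h + 16 * ρ′)) (2*C2 N) ⟨
    4 * (2 * (N C 2)) + (4 * h + 16 * ρ′)       ≡⟨ cong (_+ (4 * h + 16 * ρ′)) (sym (*-assoc 4 2 (N C 2))) ⟩
    8 * (N C 2) + (4 * h + 16 * ρ′) ∎))
  where
  open ≤-Reasoning
  N ε i ρ′ : ℕ
  N  = n / 2
  ε  = n % 2
  -- Two unpaired vertices force `h` below `N`, so this subtraction is exact and `n` can be written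
  -- in terms of `ε`, `h` and `i`.
  i  = N ∸ suc h
  ρ′ = n ∸ 2 * h

  2h≤n : 2 * h ≤ n
  2h≤n = ≤-trans (m≤m+n (2 * h) ρ) hρ≤n

  ρ≤ρ′ : ρ ≤ ρ′
  ρ≤ρ′ = subst (_≤ ρ′) (m+n∸m≡n (2 * h) ρ) (∸-monoˡ-≤ (2 * h) hρ≤n)

  h<N : suc h ≤ N
  h<N = subst (_≤ N) (m*n/n≡m (suc h) 2) (/-monoˡ-≤ 2 (begin
    suc h * 2   ≡⟨ cong (2 +_) (*-comm h 2) ⟩
    2 + 2 * h   ≡⟨ +-comm 2 (2 * h) ⟩
    2 * h + 2   ≤⟨ +-monoʳ-≤ (2 * h) 2≤ρ ⟩
    2 * h + ρ   ≤⟨ hρ≤n ⟩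
    n ∎))

  N≡ : N ≡ suc h + i
  N≡ = sym (m+[n∸m]≡n h<N)

  n≡ε : n ≡ ε + 2 * (suc h + i)
  n≡ε = trans (m≡m%n+[m/n]*n n 2) (cong (ε +_) (trans (*-comm N 2) (cong (2 *_) N≡)))

  ρ′≡ : ρ′ ≡ ε + 2 * suc i
  ρ′≡ = +-cancelˡ-≡ (2 * h) _ _ (trans (m+[n∸m]≡n 2h≤n) (trans n≡ε (arith ε h i)))
    where
    arith : ∀ ε h i → ε + 2 * (suc h + i) ≡ 2 * h + (ε + 2 * suc i)
    arith = solve-∀

  square-pred : ∀ h → h * (h ∸ 1) + h ≡ h * h
  square-pred zero    = refl
  square-pred (suc h) = trans (+-comm (suc h * h) (suc h)) (sym (*-suc (suc h) h))

  8m≤ : 8 * m ≤ 4 * (h * (h ∸ 1)) + t * ρ′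
  8m≤ = begin
    8 * m                                     ≤⟨ *-monoʳ-≤ 8 m≤ ⟩
    8 * (h C 2 + (s + b * 54))                ≡⟨ arith (h C 2) s b ⟩
    4 * (2 * (h C 2)) + (8 * s + 432 * b)     ≤⟨ +-mono-≤ (≤-reflexive (cong (4 *_) (2*C2 h))) (+-mono-≤ s≤ (*-monoˡ-≤ b 432≤t)) ⟩
    4 * (h * (h ∸ 1)) + (t * g + t * b)       ≡⟨ cong (4 * (h * (h ∸ 1)) +_) (*-distribˡ-+ t g b) ⟨
    4 * (h * (h ∸ 1)) + t * (g + b)           ≤⟨ +-monoʳ-≤ _ (*-monoʳ-≤ t (≤-trans gb≤ρ ρ≤ρ′)) ⟩
    4 * (h * (h ∸ 1)) + t * ρ′ ∎
    where
    arith : ∀ c s b → 8 * (c + (s + b * 54)) ≡ 4 * (2 * c) + (8 * s + 432 * b)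
    arith = solve-∀

  arith₁ : ∀ x h t ρ → 4 * x + t * ρ + (4 * h + 16 * ρ) ≡ 4 * (x + h) + (t + 16) * ρ
  arith₁ = solve-∀

  by-parity : ∀ ε → ε < 2 → 4 * (h * h) + (ε + 2 * (suc h + i)) * (ε + 2 * suc i)
    ≤ 4 * ((suc h + i) * (h + i)) + (4 * h + 16 * (ε + 2 * suc i))
  -- The last summand on the left of `arith` is the exact difference of the two sides, with
  -- nonnegative coefficients in `h` and `i`; the odd case is alike.
  by-parity 0 _ = m+n≤o⇒m≤o _ (≤-reflexive (arith h i))
    where
    arith : ∀ h i → 4 * (h * h) + (0 + 2 * (suc h + i)) * (0 + 2 * suc i) + (4 * (i * h) + 4 * h + 28 * i + 28)
      ≡ 4 * ((suc h + i) * (h + i)) + (4 * h + 16 * (0 + 2 * suc i))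
    arith = solve-∀
  by-parity 1 _ = m+n≤o⇒m≤o _ (≤-reflexive (arith h i))
    where
    arith : ∀ h i → 4 * (h * h) + (1 + 2 * (suc h + i)) * (1 + 2 * suc i) + (4 * (h * i) + 2 * h + 24 * i + 39)
      ≡ 4 * ((suc h + i) * (h + i)) + (4 * h + 16 * (1 + 2 * suc i))
    arith = solve-∀
  by-parity (suc (suc _)) (s≤s (s≤s ()))

-- The lower bound on the maximum degree

-- The degree bound is multiplied by 32 and freed of subtraction. The threshold 448 is 432 + 16,
-- which makes `t` at least 432.
maxDegree-bound : ∀ n → 448 ≤ n → (H : FourGraph n) → P42-free H →
  (n / 2) C 2 + 1 ≤ numEdges H → n * n ≤ 32 * maxDegree H + 32 * n
maxDegree-bound n n≥ H free many with n * n ≤? 32 * maxDegree H + 32 * n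
... | yes le = le
... | no gt = contradiction few (<⇒≱ (subst (_≤ numEdges H) (+-comm _ 1) many))
  where
  open Structure H free
  t : ℕ
  -- If the claim fails, `32 * maxDegree H` is below n² - 32n, hence below (n - 16)²; this square is
  -- what `geometric-mean` needs.
  t = n ∸ 16

  n≡ : n ≡ t + 16
  n≡ = sym (m∸n+n≡m (≤-trans (m≤m+n 16 432) n≥))

  Δ≤ : 32 * maxDegree H ≤ t * t
  Δ≤ = +-cancelʳ-≤ (32 * n) _ _ (begin
    32 * maxDegree H + 32 * n ≤⟨ <⇒≤ (≰⇒> gt) ⟩
    n * n                     ≡⟨ cong₂ _*_ n≡ n≡ ⟩
    (t + 16) * (t + 16)       ≤⟨ m≤m+n _ 256 ⟩
    (t + 16) * (t + 16) + 256 ≡⟨ arith t ⟩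
    t * t + 32 * (t + 16)     ≡⟨ cong (λ x → t * t + 32 * x) n≡ ⟨
    t * t + 32 * n ∎)
    where
    open ≤-Reasoning
    arith : ∀ t → (t + 16) * (t + 16) + 256 ≡ t * t + 32 * (t + 16)
    arith = solve-∀

  hρ≤n : 2 * length P + length unpaired ≤ n
  hρ≤n = subst (λ k → k + length unpaired ≤ n) length-paired length-paired+unpaired

  h≤N : length P ≤ n / 2
  h≤N = subst (_≤ n / 2) (m*n/n≡m (length P) 2)
    (/-monoˡ-≤ 2 (≤-trans (≤-reflexive (*-comm (length P) 2)) (m+n≤o⇒m≤o _ hρ≤n)))

  few : numEdges H ≤ (n / 2) C 2
  few with 2 ≤? length unpaired
  ... | yes 2≤ = count-≤-C2 {h = length P} {s = length (concatMap star P)} n≡ (∸-monoˡ-≤ 16 n≥) hρ≤n 2≤ length-good+bad (stars-≤ t Δ≤) numEdges-≤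
  ... | no ¬2≤ = ≤-trans (numEdges-≤-small (≰⇒> ¬2≤)) (C2-mono h≤N)

theorem1 : (Σ ℕ λ n₁ → ∀ n → n₁ ≤ n → (H : FourGraph n) → P42-free H →
    (n / 2) C 2 + 1 ≤ numEdges H →
    n * n ≤ 32 * maxDegree H + 32 * n)
    × (∀ n → 4 ≤ n → Σ (FourGraph n) λ H₀ → P42-free H₀ ×
    numEdges H₀ ≡ (n / 2) C 2 × maxDegree H₀ ≡ n / 2 ∸ 1)
theorem1 =
  (448 , maxDegree-bound) ,
  λ n n≥4 → let open PairedVertices n in
    graph , graph-free , numEdges-graph ,
    -- `n≥4` ensures that the block with index 0 exists; its left vertex attains the maximum degree.
    maxDegree-graph (fromℕ< {0} (≤-trans (s≤s z≤n) (/-monoˡ-≤ 2 n≥4)))
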